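{- Let $n \geq 1$, $G := \mathbb{F}_2^n$, and let $A \subset G$ have density $\alpha := |A|/|G| > 1/2 - \epsilon$, where $\epsilon \in (0, 1/(2^9\sqrt{n})]$. Then $A+A$ contains a (linear) subspace of $G$ of co-dimension $1$.
   Context: $A+A := \{a+a' : a,a' \in A\}$. -}

module Defs where

open import Data.Bool using (Bool; true; false; _xor_)
open import Data.Nat using (ℕ; zero; suc; _+_)
open import Data.Vec using (Vec; []; _∷_; zipWith; replicate)
open import Data.List using (List; []; _∷_; map; _++_; length; filter)
open import Data.Product using (Σ; _×_; ∃-syntax)
open import Data.Sum using (_⊎_)
open import Data.Integer using (+_)
open import Data.Rational using (ℚ; _/_)
open import Relation.Binary.PropositionalEquality using (_≡_)
open import Relation.Nullary using (¬_)
open import Data.Bool using (T)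
open import Relation.Nullary.Decidable using (Dec; yes; no)

G : ℕ → Set
G n = Vec Bool n

_⊕_ : ∀ {n} → G n → G n → G n
_⊕_ = zipWith _xor_

𝟘 : ∀ n → G n
𝟘 n = replicate n false

allG : ∀ n → List (G n)
allG zero = [] ∷ []
allG (suc n) = map (false ∷_) (allG n) ++ map (true ∷_) (allG n)

card : ∀ {n} → (G n → Bool) → ℕ
card {n} A = length (filter (λ x → Data.Bool._≟_ (A x) true) (allG n))

ℕ→ℚ : ℕ → ℚ
ℕ→ℚ k = + k / 1

_+ₛ_ : ∀ {n} → (G n → Bool) → (G n → Bool) → G n → Set
_+ₛ_ A B x = ∃[ a ] ∃[ b ] (A a ≡ true × B b ≡ true × x ≡ a ⊕ b)

-- A (linear) subspace of F₂ⁿ: contains 0, closed under addition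
-- (scalar multiplication over F₂ is then automatic).
record IsSubspace {n} (V : G n → Set) : Set where
  field
    zero∈ : V (𝟘 n)
    +-closed : ∀ x y → V x → V y → V (x ⊕ y)

-- Codimension 1: the quotient G/V has exactly two cosets, i.e. there is
-- v ∉ V with G = V ∪ (v + V).
record IsCodim1Subspace {n} (V : G n → Set) : Set where
  field
    subspace : IsSubspace V
    v : G n
    v∉V : ¬ V v
    cover : ∀ x → V x ⊎ V (x ⊕ v)

{-# OPTIONS --safe #-}
-- Let S be the complement of A + A, and suppose w ∈ S (if S is empty any hyperplane will do).
-- By Gaussian elimination either some γ is 1 on w and 0 on S + w, so that γ = 1 on S and the
-- hyperplane γ = 0 lies in A + A; or w is a sum of at most n elements zᵢ of S + w.
--
-- In the second case put B = {x : x + w ∉ A}. Then A ⊆ B and A + zᵢ ⊆ B, so on every "cube"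
-- g + ⟨z₁, …, z_d⟩ (with multiplicities) B contains the vertex neighbourhood of A. An induction
-- on d bounds the density ν of B from below by μ + c μ (1 − μ) − d c³/16, for μ the density of A
-- and any c ≥ 0. On the other hand ν = 1 − μ, because w = z₁ + ⋯ + z_d maps the cube to itself.
-- With c = 16 ε this forces μ ≤ ½ − ε on every cube, hence on average over g.
module Submission where

open import Defs
open import Data.Bool using (Bool; true; false; not; _xor_; _∧_) renaming (_≟_ to _≟ᵇ_)
open import Data.Bool.Properties
  using (xor-assoc; xor-comm; xor-identityˡ; xor-identityʳ; xor-same; ∧-distribˡ-xor; ∧-identityʳ; ∧-zeroʳ; ¬-not)
open import Data.Empty using (⊥-elim)
import Data.Integer as ℤ
import Data.Integer.Properties as ℤₚ
open import Data.List as List using (List; []; _∷_; _++_; length; filter)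
open import Data.List.Membership.Propositional using (_∈_; find; lose)
open import Data.List.Membership.Propositional.Properties using (∈-map⁺; ∈-map⁻; ∈-++⁺ˡ; ∈-++⁺ʳ; ∈-filter⁺; ∈-filter⁻)
open import Data.List.Properties using (filter-++; length-++)
open import Data.List.Relation.Unary.All as All using (All; []; _∷_)
import Data.List.Relation.Unary.All.Properties as Allₚ
open import Data.List.Relation.Unary.Any using (here; any?)
open import Data.Nat as ℕ using (ℕ; zero; suc; _≥_; _^_; z≤n; s≤s) renaming (_*_ to _*ℕ_)
import Data.Nat.Properties as ℕₚ
open import Data.Product using (_×_; ∃-syntax; _,_; proj₂)
open import Data.Rational using (ℚ; _<_; _≤_; _*_; _-_; _+_; -_; ½; 0ℚ; 1ℚ; _/_; toℚᵘ; nonNegative)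
import Data.Rational.Properties as ℚₚ
open import Data.Rational.Solver using (module +-*-Solver)
import Data.Rational.Unnormalised as ℚᵘ
import Data.Rational.Unnormalised.Properties as ℚᵘₚ
open import Data.Sum using (_⊎_; inj₁; inj₂; [_,_]′)
open import Data.Vec using ([]; _∷_; head)
open import Data.Vec.Properties using (zipWith-assoc; zipWith-comm; zipWith-identityˡ; zipWith-identityʳ)
open import Function using (_∘_; id)
open import Relation.Binary.PropositionalEquality
  using (_≡_; refl; sym; trans; cong; cong₂; subst; subst₂; module ≡-Reasoning)
open import Relation.Nullary using (¬_; Dec; yes; no; contradiction)
open import Relation.Nullary.Decidable using (_×-dec_; ¬?; decidable-stable)
open +-*-Solver using (solve; _:=_; _:+_; _:*_; _:-_; con)

-- Addition in F₂ⁿ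

⊕-assoc : ∀ {n} (x y z : G n) → (x ⊕ y) ⊕ z ≡ x ⊕ (y ⊕ z)
⊕-assoc = zipWith-assoc xor-assoc

⊕-comm : ∀ {n} (x y : G n) → x ⊕ y ≡ y ⊕ x
⊕-comm = zipWith-comm xor-comm

⊕-identityˡ : ∀ {n} (x : G n) → 𝟘 n ⊕ x ≡ x
⊕-identityˡ = zipWith-identityˡ xor-identityˡ

⊕-identityʳ : ∀ {n} (x : G n) → x ⊕ 𝟘 n ≡ x
⊕-identityʳ = zipWith-identityʳ xor-identityʳ

⊕-same : ∀ {n} (x : G n) → x ⊕ x ≡ 𝟘 n
⊕-same []      = refl
⊕-same (b ∷ x) = cong₂ _∷_ (xor-same b) (⊕-same x)

⊕-cancelʳ : ∀ {n} (x y : G n) → (x ⊕ y) ⊕ y ≡ x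
⊕-cancelʳ x y = trans (⊕-assoc x y y) (trans (cong (x ⊕_) (⊕-same y)) (⊕-identityʳ x))

⊕-cancelˡ : ∀ {n} (x y : G n) → x ⊕ (x ⊕ y) ≡ y
⊕-cancelˡ x y = trans (sym (⊕-assoc x x y)) (trans (cong (_⊕ y) (⊕-same x)) (⊕-identityˡ y))

⊕-swapʳ : ∀ {n} (x y z : G n) → (x ⊕ y) ⊕ z ≡ (x ⊕ z) ⊕ y
⊕-swapʳ x y z = trans (⊕-assoc x y z) (trans (cong (x ⊕_) (⊕-comm y z)) (sym (⊕-assoc x z y)))

⊕-interchange : ∀ {n} (x y z w : G n) → (x ⊕ y) ⊕ (z ⊕ w) ≡ (x ⊕ z) ⊕ (y ⊕ w)
⊕-interchange x y z w = trans (sym (⊕-assoc (x ⊕ y) z w))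
  (trans (cong (_⊕ w) (⊕-swapʳ x y z)) (⊕-assoc (x ⊕ z) y w))

∈-allG : ∀ {n} (x : G n) → x ∈ allG n
∈-allG []          = here refl
∈-allG (false ∷ x) = ∈-++⁺ˡ (∈-map⁺ _ (∈-allG x))
∈-allG (true ∷ x)  = ∈-++⁺ʳ _ (∈-map⁺ _ (∈-allG x))

-- Linear functionals and Gaussian elimination over F₂

⨁ : ∀ {n} → List (G n) → G n
⨁ {n} = List.foldr _⊕_ (𝟘 n)

dot : ∀ {n} → G n → G n → Bool
dot []      []      = false
dot (a ∷ γ) (b ∷ x) = (a ∧ b) xor dot γ x

xor-interchange : ∀ a b c d → (a xor b) xor (c xor d) ≡ (a xor c) xor (b xor d)
xor-interchange a b c d = cong head (⊕-interchange (a ∷ []) (b ∷ []) (c ∷ []) (d ∷ []))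

dot-⊕ : ∀ {n} (γ x y : G n) → dot γ (x ⊕ y) ≡ dot γ x xor dot γ y
dot-⊕ []      []      []      = refl
dot-⊕ (a ∷ γ) (b ∷ x) (c ∷ y) =
  trans (cong₂ _xor_ (∧-distribˡ-xor a b c) (dot-⊕ γ x y))
        (xor-interchange (a ∧ b) (a ∧ c) (dot γ x) (dot γ y))

dot-𝟘ˡ : ∀ {n} (x : G n) → dot (𝟘 n) x ≡ false
dot-𝟘ˡ []      = refl
dot-𝟘ˡ (b ∷ x) = dot-𝟘ˡ x

dot-𝟘ʳ : ∀ {n} (γ : G n) → dot γ (𝟘 n) ≡ false
dot-𝟘ʳ []      = refl
dot-𝟘ʳ (a ∷ γ) = cong₂ _xor_ (∧-zeroʳ a) (dot-𝟘ʳ γ)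

-- Gaussian elimination of the first coordinate with pivot (true ∷ p).
reduce : ∀ {n} → G n → G (suc n) → G n
reduce p (false ∷ x) = x
reduce p (true ∷ x)  = x ⊕ p

reduce-⊕ : ∀ {n} (p : G n) x y → reduce p (x ⊕ y) ≡ reduce p x ⊕ reduce p y
reduce-⊕ p (false ∷ x) (false ∷ y) = refl
reduce-⊕ p (false ∷ x) (true ∷ y)  = ⊕-assoc x y p
reduce-⊕ p (true ∷ x)  (false ∷ y) = ⊕-swapʳ x y p
reduce-⊕ p (true ∷ x)  (true ∷ y)  = sym (trans (⊕-interchange x p y p)
  (trans (cong ((x ⊕ y) ⊕_) (⊕-same p)) (⊕-identityʳ (x ⊕ y))))

-- The linear map `reduce p` has kernel {0, `true ∷ p`}. This is why lifting a sum back costs at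
-- most one more summand.
reduce-kernel : ∀ {n} (p : G n) x y → reduce p x ≡ reduce p y → x ≡ y ⊎ x ≡ (true ∷ p) ⊕ y
reduce-kernel p (false ∷ x) (false ∷ y) eq = inj₁ (cong (false ∷_) eq)
reduce-kernel p (false ∷ x) (true ∷ y)  eq = inj₂ (cong (false ∷_) (trans eq (⊕-comm y p)))
reduce-kernel p (true ∷ x)  (false ∷ y) eq =
  inj₂ (cong (true ∷_) (trans (sym (⊕-cancelʳ x p)) (trans (cong (_⊕ p) eq) (⊕-comm y p))))
reduce-kernel p (true ∷ x)  (true ∷ y)  eq =
  inj₁ (cong (true ∷_) (trans (sym (⊕-cancelʳ x p)) (trans (cong (_⊕ p) eq) (⊕-cancelʳ y p))))

-- The first coordinate `dot γ p` is the one that makes the pulled-back functional vanish on the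
-- pivot: over F₂ the two copies of `dot γ p` cancel.
dot-reduce : ∀ {n} (γ p : G n) x → dot (dot γ p ∷ γ) x ≡ dot γ (reduce p x)
dot-reduce γ p (false ∷ x) = cong (_xor dot γ x) (∧-zeroʳ (dot γ p))
dot-reduce γ p (true ∷ x)  = trans (cong (_xor dot γ x) (∧-identityʳ (dot γ p)))
  (trans (xor-comm (dot γ p) (dot γ x)) (sym (dot-⊕ γ x p)))

⨁-lift : ∀ {n} (p : G n) {L} zs → All (_∈ List.map (reduce p) L) zs →
  ∃[ ys ] (All (_∈ L) ys × length ys ≡ length zs × reduce p (⨁ ys) ≡ ⨁ zs)
⨁-lift p []       []         = [] , [] , refl , refl
⨁-lift p (z ∷ zs) (z∈ ∷ zs∈) with ∈-map⁻ (reduce p) z∈ | ⨁-lift p zs zs∈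
... | y , y∈L , refl | ys , ys∈L , len , eq =
  y ∷ ys , y∈L ∷ ys∈L , cong suc len , trans (reduce-⊕ p y (⨁ ys)) (cong (reduce p y ⊕_) eq)

head-⨁ : ∀ {n} {zs : List (G (suc n))} → All (λ z → head z ≡ false) zs → head (⨁ zs) ≡ false
head-⨁ [] = refl
head-⨁ {zs = (_ ∷ _) ∷ zs} (h ∷ hs) with ⨁ zs | head-⨁ hs
... | _ ∷ _ | eq = cong₂ _xor_ h eq

Separated : ∀ {n} → List (G n) → G n → Set
Separated L w = ∃[ γ ] (dot γ w ≡ true × All (λ z → dot γ z ≡ false) L)

ShortSum : ∀ {n} → List (G n) → G n → Set
ShortSum {n} L w = ∃[ zs ] (All (_∈ L) zs × length zs ℕ.≤ n × ⨁ zs ≡ w)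

separate-reduce : ∀ {n} (p : G n) {L w} →
  Separated (List.map (reduce p) L) (reduce p w) → Separated L w
separate-reduce p {w = w} (γ , γw , γL) =
  dot γ p ∷ γ , trans (dot-reduce γ p w) γw ,
  All.map (λ {z} → trans (dot-reduce γ p z)) (Allₚ.map⁻ γL)

separate-or-sum : ∀ {n} (L : List (G n)) (w : G n) → Separated L w ⊎ ShortSum L w
separate-or-sum {zero} L [] = inj₂ ([] , [] , z≤n , refl)
separate-or-sum {suc n} L w with any? (λ z → head z ≟ᵇ true) L
... | yes pivot with find pivot
...   | true ∷ p , p∈L , refl with separate-or-sum (List.map (reduce p) L) (reduce p w)
...     | inj₁ sep = inj₁ (separate-reduce p sep)
...     | inj₂ (zs , zs∈ , len , eq) with ⨁-lift p zs zs∈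
...       | ys , ys∈L , len′ , eq′ with reduce-kernel p w (⨁ ys) (sym (trans eq′ eq))
...         | inj₁ w≡ = inj₂ (ys , ys∈L , ℕₚ.m≤n⇒m≤1+n (subst (ℕ._≤ n) (sym len′) len) , sym w≡)
...         | inj₂ w≡ =
  inj₂ ((true ∷ p) ∷ ys , p∈L ∷ ys∈L , s≤s (subst (ℕ._≤ n) (sym len′) len) , sym w≡)
separate-or-sum {suc n} L w | no ¬pivot = go w
  where
  heads : All (λ z → head z ≡ false) L
  heads = All.map ¬-not (Allₚ.¬Any⇒All¬ L ¬pivot)

  go : ∀ w → Separated L w ⊎ ShortSum L w
  go (true ∷ w) = inj₁ (true ∷ 𝟘 n , cong not (dot-𝟘ˡ w) , All.map (λ {z} → first z) heads)
    where
    first : ∀ z → head z ≡ false → dot (true ∷ 𝟘 n) z ≡ false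
    first (b ∷ z) h = cong₂ _xor_ h (dot-𝟘ˡ z)
  -- No pivot is at hand; with `𝟘 n` in its place `reduce` just deletes the first coordinate.
  go (false ∷ w) with separate-or-sum (List.map (reduce (𝟘 n)) L) w
  ... | inj₁ sep = inj₁ (separate-reduce (𝟘 n) sep)
  ... | inj₂ (zs , zs∈ , len , eq) with ⨁-lift (𝟘 n) zs zs∈
  ...   | ys , ys∈L , len′ , eq′ =
    inj₂ (ys , ys∈L , ℕₚ.m≤n⇒m≤1+n (subst (ℕ._≤ n) (sym len′) len) ,
          unreduce (⨁ ys) (head-⨁ (All.map (All.lookup heads) ys∈L)) (trans eq′ eq))
    where
    unreduce : ∀ x → head x ≡ false → reduce (𝟘 n) x ≡ w → x ≡ false ∷ w
    unreduce (false ∷ x) refl eq = cong (false ∷_) eq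

hyperplane : ∀ {n} (γ v : G n) → dot γ v ≡ true → IsCodim1Subspace (λ x → dot γ x ≡ false)
hyperplane γ v γv = record
  { subspace = record
    { zero∈    = dot-𝟘ʳ γ
    ; +-closed = λ x y γx γy → trans (dot-⊕ γ x y) (cong₂ _xor_ γx γy)
    }
  ; v     = v
  ; v∉V   = λ γv′ → contradiction (trans (sym γv) γv′) λ ()
  ; cover = cover
  }
  where
  cover : ∀ x → dot γ x ≡ false ⊎ dot γ (x ⊕ v) ≡ false
  cover x with dot γ x in γx
  ... | false = inj₁ refl
  ... | true  = inj₂ (trans (dot-⊕ γ x v) (cong₂ _xor_ γx γv))

-- Inequalities between rationals

≤⇒0≤- : ∀ {p q} → p ≤ q → 0ℚ ≤ q - p
≤⇒0≤- {p} {q} p≤q = subst (_≤ q - p) (ℚₚ.+-inverseʳ p) (ℚₚ.+-monoˡ-≤ (- p) p≤q)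

<⇒0<- : ∀ {p q} → p < q → 0ℚ < q - p
<⇒0<- {p} {q} p<q = subst (_< q - p) (ℚₚ.+-inverseʳ p) (ℚₚ.+-monoˡ-< (- p) p<q)

0≤-⇒≤ : ∀ {p q} → 0ℚ ≤ q - p → p ≤ q
0≤-⇒≤ {p} {q} 0≤ = subst₂ _≤_ (ℚₚ.+-identityˡ p)
  (solve 2 (λ p q → q :- p :+ p := q) refl p q) (ℚₚ.+-monoˡ-≤ p 0≤)

infixl 6 _⊹_
_⊹_ : ∀ {p q} → 0ℚ ≤ p → 0ℚ ≤ q → 0ℚ ≤ p + q
_⊹_ = ℚₚ.+-mono-≤

infixl 7 _⊠_
_⊠_ : ∀ {p q} → 0ℚ ≤ p → 0ℚ ≤ q → 0ℚ ≤ p * q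
_⊠_ {p} {q} 0≤p 0≤q = subst (_≤ p * q) (ℚₚ.*-zeroʳ p)
  (ℚₚ.*-monoˡ-≤-nonNeg p {{nonNegative 0≤p}} 0≤q)

0≤p² : ∀ p → 0ℚ ≤ p * p
0≤p² p with ℚₚ.≤-total 0ℚ p
... | inj₁ 0≤p = 0≤p ⊠ 0≤p
... | inj₂ p≤0 = subst (0ℚ ≤_) (solve 1 (λ p → (con 0ℚ :- p) :* (con 0ℚ :- p) := p :* p) refl p)
  (≤⇒0≤- p≤0 ⊠ ≤⇒0≤- p≤0)

0≤½ : 0ℚ ≤ ½
0≤½ = ℚₚ.nonNegative⁻¹ ½

-- The two-point inequality

-- The gain `c * (μ * (1ℚ - μ))` vanishes at densities 0 and 1, hence at a single vertex, and peaks
-- at ½; `e` collects the loss over the dimensions.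
profile : ℚ → ℚ → ℚ → ℚ
profile c e μ = μ + c * (μ * (1ℚ - μ)) - e

1/16 : ℚ
1/16 = ½ * ½ * ½ * ½

-- Both ν are at least μ₁, which exceeds the mean of μ₀ and μ₁ by at least c/4, and t(1 - t) ≤ 1/4
-- bounds the gain by c/4.
unbalanced : ∀ c e μ₀ μ₁ {ν₀ ν₁} → 0ℚ ≤ c → 0ℚ ≤ e → μ₁ ≤ ν₀ → μ₁ ≤ ν₁ → c * ½ ≤ μ₁ - μ₀ →
  profile c (e + c * c * c * 1/16) (½ * (μ₀ + μ₁)) ≤ ½ * (ν₀ + ν₁)
unbalanced c e μ₀ μ₁ {ν₀} {ν₁} 0≤c 0≤e p q far = 0≤-⇒≤ (subst (0ℚ ≤_)
  (solve 6 (λ c e m₀ m₁ n₀ n₁ →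
      con ½ :* (n₀ :- m₁) :+ con ½ :* (n₁ :- m₁) :+ con ½ :* (m₁ :- m₀ :- c :* con ½)
        :+ c :* ((con ½ :- con ½ :* (m₀ :+ m₁)) :* (con ½ :- con ½ :* (m₀ :+ m₁)))
        :+ (e :+ c :* c :* c :* con 1/16)
      := con ½ :* (n₀ :+ n₁)
        :- (con ½ :* (m₀ :+ m₁) :+ c :* (con ½ :* (m₀ :+ m₁) :* (con 1ℚ :- con ½ :* (m₀ :+ m₁)))
            :- (e :+ c :* c :* c :* con 1/16)))
    refl c e μ₀ μ₁ ν₀ ν₁)
  (0≤½ ⊠ ≤⇒0≤- p ⊹ 0≤½ ⊠ ≤⇒0≤- q ⊹ 0≤½ ⊠ ≤⇒0≤- far
    ⊹ 0≤c ⊠ 0≤p² (½ - ½ * (μ₀ + μ₁)) ⊹ (0≤e ⊹ 0≤c ⊠ 0≤c ⊠ 0≤c ⊠ ℚₚ.nonNegative⁻¹ 1/16)))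

-- Averaging the two bounds misses the bound at the mean by c (μ₁ - μ₀)²/4, the concavity defect. As
-- |μ₁ - μ₀| ≤ c/2, this is at most c³/16, the source of `1/16`.
balanced : ∀ c e μ₀ μ₁ {ν₀ ν₁} → 0ℚ ≤ c → profile c e μ₀ ≤ ν₀ → profile c e μ₁ ≤ ν₁ →
  μ₁ - μ₀ ≤ c * ½ → μ₀ - μ₁ ≤ c * ½ →
  profile c (e + c * c * c * 1/16) (½ * (μ₀ + μ₁)) ≤ ½ * (ν₀ + ν₁)
balanced c e μ₀ μ₁ {ν₀} {ν₁} 0≤c p q near near′ = 0≤-⇒≤ (subst (0ℚ ≤_)
  (solve 6 (λ c e m₀ m₁ n₀ n₁ →
      con ½ :* (n₀ :- (m₀ :+ c :* (m₀ :* (con 1ℚ :- m₀)) :- e))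
        :+ con ½ :* (n₁ :- (m₁ :+ c :* (m₁ :* (con 1ℚ :- m₁)) :- e))
        -- This product is c/4 times (c/2)² - (μ₁ - μ₀)², the slack in the estimate of the defect.
        :+ con (½ * ½) :* c :* (c :* con ½ :- (m₁ :- m₀)) :* (c :* con ½ :- (m₀ :- m₁))
      := con ½ :* (n₀ :+ n₁)
        :- (con ½ :* (m₀ :+ m₁) :+ c :* (con ½ :* (m₀ :+ m₁) :* (con 1ℚ :- con ½ :* (m₀ :+ m₁)))
            :- (e :+ c :* c :* c :* con 1/16)))
    refl c e μ₀ μ₁ ν₀ ν₁)
  (0≤½ ⊠ ≤⇒0≤- p ⊹ 0≤½ ⊠ ≤⇒0≤- q
    ⊹ ℚₚ.nonNegative⁻¹ (½ * ½) ⊠ 0≤c ⊠ ≤⇒0≤- near ⊠ ≤⇒0≤- near′))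

-- Either the two halves differ so much in density that both neighbourhoods inherit the larger
-- one, or the concavity of μ (1 − μ) costs at most c³/16.
two-point : ∀ c e {μ₀ μ₁ ν₀ ν₁} → 0ℚ ≤ c → 0ℚ ≤ e →
  μ₀ ≤ ν₀ → μ₀ ≤ ν₁ → μ₁ ≤ ν₀ → μ₁ ≤ ν₁ → profile c e μ₀ ≤ ν₀ → profile c e μ₁ ≤ ν₁ →
  profile c (e + c * c * c * 1/16) (½ * (μ₀ + μ₁)) ≤ ½ * (ν₀ + ν₁)
two-point c e {μ₀} {μ₁} {ν₀} {ν₁} 0≤c 0≤e p₀₀ p₀₁ p₁₀ p₁₁ q₀ q₁
  with ℚₚ.≤-total (c * ½) (μ₁ - μ₀) | ℚₚ.≤-total (c * ½) (μ₀ - μ₁)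
... | inj₁ far  | _         = unbalanced c e μ₀ μ₁ 0≤c 0≤e p₁₀ p₁₁ far
... | inj₂ _    | inj₁ far  =
  subst₂ (λ μ ν → profile c (e + c * c * c * 1/16) (½ * μ) ≤ ½ * ν) (ℚₚ.+-comm μ₁ μ₀) (ℚₚ.+-comm ν₁ ν₀)
    (unbalanced c e μ₁ μ₀ 0≤c 0≤e p₀₁ p₀₀ far)
... | inj₂ near | inj₂ near′ = balanced c e μ₀ μ₁ 0≤c q₀ q₁ near near′

-- Averages over cubes

-- The mean of f over g + Σ I, where I ranges over the sublists of zs.
average : ∀ {n} → List (G n) → (G n → ℚ) → G n → ℚ
average []       f g = f g
average (z ∷ zs) f g = ½ * (average zs f g + average zs f (g ⊕ z))

average-mono : ∀ {n} (zs : List (G n)) {f h} → (∀ x → f x ≤ h x) → ∀ g → average zs f g ≤ average zs h g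
average-mono []       f≤h g = f≤h g
average-mono (z ∷ zs) f≤h g = ℚₚ.*-monoˡ-≤-nonNeg ½
  (ℚₚ.+-mono-≤ (average-mono zs f≤h g) (average-mono zs f≤h (g ⊕ z)))

average-shift : ∀ {n} (zs : List (G n)) f w g → average zs (λ x → f (x ⊕ w)) g ≡ average zs f (g ⊕ w)
average-shift []       f w g = refl
average-shift (z ∷ zs) f w g = cong₂ (λ a b → ½ * (a + b)) (average-shift zs f w g)
  (trans (average-shift zs f w (g ⊕ z)) (cong (average zs f) (⊕-swapʳ g z w)))

average-complement : ∀ {n} (zs : List (G n)) f g → average zs (λ x → 1ℚ - f x) g ≡ 1ℚ - average zs f g
average-complement []       f g = refl
average-complement (z ∷ zs) f g = trans
  (cong₂ (λ a b → ½ * (a + b)) (average-complement zs f g) (average-complement zs f (g ⊕ z)))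
  (solve 2 (λ a b → con ½ :* (con 1ℚ :- a :+ (con 1ℚ :- b)) := con 1ℚ :- con ½ :* (a :+ b)) refl
    (average zs f g) (average zs f (g ⊕ z)))

-- Replacing a sublist by its complement translates its sum by ⨁ zs.
average-⨁ : ∀ {n} (zs : List (G n)) f g → average zs f (g ⊕ ⨁ zs) ≡ average zs f g
average-⨁ []       f g = cong f (⊕-identityʳ g)
average-⨁ (z ∷ zs) f g = trans
  (cong₂ (λ a b → ½ * (a + b))
    (trans (cong (average zs f) (sym (⊕-assoc g z (⨁ zs)))) (average-⨁ zs f (g ⊕ z)))
    (trans (cong (average zs f) back) (average-⨁ zs f g)))
  (cong (½ *_) (ℚₚ.+-comm (average zs f (g ⊕ z)) (average zs f g)))
  where
  back : (g ⊕ (z ⊕ ⨁ zs)) ⊕ z ≡ g ⊕ ⨁ zs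
  back = trans (⊕-assoc g (z ⊕ ⨁ zs) z)
    (cong (g ⊕_) (trans (⊕-comm (z ⊕ ⨁ zs) z) (⊕-cancelˡ z (⨁ zs))))

-- Natural numbers as rationals

-- `_/_` normalises by a gcd that is stuck on variables, so the sum is computed on unnormalised
-- fractions of denominator 1 and carried back.
ℕ→ℚ-+ : ∀ a b → ℕ→ℚ (a ℕ.+ b) ≡ ℕ→ℚ a + ℕ→ℚ b
ℕ→ℚ-+ a b = ℚₚ.toℚᵘ-injective (begin
  toℚᵘ (ℕ→ℚ (a ℕ.+ b))             ≈⟨ ℚₚ.toℚᵘ-fromℚᵘ (ℤ.+ (a ℕ.+ b) ℚᵘ./ 1) ⟩
  ℤ.+ (a ℕ.+ b) ℚᵘ./ 1             ≈⟨ ℚᵘ.*≡* (cong (ℤ._* ℤ.+ 1)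
                                        (cong₂ ℤ._+_ (sym (ℤₚ.*-identityʳ (ℤ.+ a))) (sym (ℤₚ.*-identityʳ (ℤ.+ b))))) ⟩
  ℤ.+ a ℚᵘ./ 1 ℚᵘ.+ ℤ.+ b ℚᵘ./ 1   ≈⟨ ℚᵘₚ.+-cong (ℚₚ.toℚᵘ-fromℚᵘ (ℤ.+ a ℚᵘ./ 1)) (ℚₚ.toℚᵘ-fromℚᵘ (ℤ.+ b ℚᵘ./ 1)) ⟨
  toℚᵘ (ℕ→ℚ a) ℚᵘ.+ toℚᵘ (ℕ→ℚ b)   ≈⟨ ℚₚ.toℚᵘ-homo-+ (ℕ→ℚ a) (ℕ→ℚ b) ⟨
  toℚᵘ (ℕ→ℚ a + ℕ→ℚ b)             ∎)
  where open ℚᵘₚ.≃-Reasoning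

ℕ→ℚ-* : ∀ a b → ℕ→ℚ (a *ℕ b) ≡ ℕ→ℚ a * ℕ→ℚ b
ℕ→ℚ-* zero    b = sym (ℚₚ.*-zeroˡ (ℕ→ℚ b))
ℕ→ℚ-* (suc a) b = begin
  ℕ→ℚ (b ℕ.+ a *ℕ b)         ≡⟨ ℕ→ℚ-+ b (a *ℕ b) ⟩
  ℕ→ℚ b + ℕ→ℚ (a *ℕ b)       ≡⟨ cong (ℕ→ℚ b +_) (ℕ→ℚ-* a b) ⟩
  ℕ→ℚ b + ℕ→ℚ a * ℕ→ℚ b      ≡⟨ solve 2 (λ a b → b :+ a :* b := (con 1ℚ :+ a) :* b) refl (ℕ→ℚ a) (ℕ→ℚ b) ⟩
  (1ℚ + ℕ→ℚ a) * ℕ→ℚ b       ≡⟨ cong (_* ℕ→ℚ b) (ℕ→ℚ-+ 1 a) ⟨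
  ℕ→ℚ (suc a) * ℕ→ℚ b        ∎
  where open ≡-Reasoning

0≤ℕ→ℚ : ∀ k → 0ℚ ≤ ℕ→ℚ k
0≤ℕ→ℚ k = ℚₚ.nonNegative⁻¹ (ℕ→ℚ k) {{ℚₚ.normalize-nonNeg k 1}}

ℕ→ℚ-mono : ∀ {a b} → a ℕ.≤ b → ℕ→ℚ a ≤ ℕ→ℚ b
ℕ→ℚ-mono {a} {b} a≤b = subst₂ _≤_ (ℚₚ.+-identityʳ (ℕ→ℚ a))
  (trans (sym (ℕ→ℚ-+ a (b ℕ.∸ a))) (cong ℕ→ℚ (ℕₚ.m+[n∸m]≡n a≤b)))
  (ℚₚ.+-monoʳ-≤ (ℕ→ℚ a) (0≤ℕ→ℚ (b ℕ.∸ a)))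

-- Isoperimetry on cubes

-- Splitting off `z` cuts the cube into parallel halves at `g` and `g ⊕ z`. Edges in direction `z`
-- make the mean of `f` on each half a lower bound for the mean of `h` on the other; edges inside
-- the halves are left to the induction, and `two-point` merges the bounds.
isoperimetry : ∀ {n} c → 0ℚ ≤ c → (zs : List (G n)) (f h : G n → ℚ) →
  (∀ x → f x * (1ℚ - f x) ≡ 0ℚ) → (∀ x → f x ≤ h x) → All (λ z → ∀ x → f (x ⊕ z) ≤ h x) zs →
  ∀ g → profile c (ℕ→ℚ (length zs) * (c * c * c * 1/16)) (average zs f g) ≤ average zs h g
-- At one vertex `f01` kills the gain and the empty list kills the loss.
isoperimetry c 0≤c [] f h f01 f≤h [] g = subst (_≤ h g) (sym (begin
  f g + c * (f g * (1ℚ - f g)) - 0ℚ * η  ≡⟨ cong (λ t → f g + c * t - 0ℚ * η) (f01 g) ⟩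
  f g + c * 0ℚ - 0ℚ * η                  ≡⟨ solve 3 (λ c a b → a :+ c :* con 0ℚ :- con 0ℚ :* b := a) refl c (f g) η ⟩
  f g                                    ∎)) (f≤h g)
  where
  open ≡-Reasoning
  η = c * c * c * 1/16
isoperimetry c 0≤c (z ∷ zs) f h f01 f≤h (fz≤h ∷ fzs≤h) g =
  subst (λ e → profile c e (average (z ∷ zs) f g) ≤ average (z ∷ zs) h g) loss
    (two-point c (d * η) 0≤c (0≤ℕ→ℚ (length zs) ⊠ (0≤c ⊠ 0≤c ⊠ 0≤c ⊠ ℚₚ.nonNegative⁻¹ 1/16))
      (average-mono zs f≤h g)
      (subst (_≤ average zs h (g ⊕ z)) (cong (average zs f) (⊕-cancelʳ g z)) (neighbour (g ⊕ z)))
      (neighbour g)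
      (average-mono zs f≤h (g ⊕ z))
      (isoperimetry c 0≤c zs f h f01 f≤h fzs≤h g)
      (isoperimetry c 0≤c zs f h f01 f≤h fzs≤h (g ⊕ z)))
  where
  d η : ℚ
  d = ℕ→ℚ (length zs)
  η = c * c * c * 1/16

  neighbour : ∀ g → average zs f (g ⊕ z) ≤ average zs h g
  neighbour g = subst (_≤ average zs h g) (average-shift zs f z g) (average-mono zs fz≤h g)

  loss : d * η + η ≡ ℕ→ℚ (suc (length zs)) * η
  loss = trans (solve 2 (λ d η → d :* η :+ η := (con 1ℚ :+ d) :* η) refl d η)
    (cong (_* η) (sym (ℕ→ℚ-+ 1 (length zs))))

-- `κ` is (2⁹)²: the condition on ε is used in squared form, free of √n.
16ℚ κ : ℚ
16ℚ = ℤ.+ 16 / 1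
κ = ℕ→ℚ (2 ^ 18)

-- If μ > ½ − ε, the nonnegative terms below, the first of them positive, would sum to 0.
density-bound : ∀ ε d N μ ν → ν ≡ 1ℚ - μ → 0ℚ < ε → d ≤ N → 1ℚ ≤ N → ε * ε * (κ * N) ≤ 1ℚ →
  μ ≤ ν → profile (16ℚ * ε) (d * (16ℚ * ε * (16ℚ * ε) * (16ℚ * ε) * 1/16)) μ ≤ ν →
  μ ≤ ½ - ε
density-bound ε d N μ _ refl 0<ε d≤N 1≤N small half iso = ℚₚ.≮⇒≥ λ dense →
  let x = ½ - μ
      0<ε-x = <⇒0<- dense
      0≤x = subst (0ℚ ≤_) (solve 1 (λ m → con ½ :* (con 1ℚ :- m :- m) := con ½ :- m) refl μ)
              (0≤½ ⊠ ≤⇒0≤- half)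
      0≤N = ℚₚ.≤-trans (ℚₚ.nonNegative⁻¹ 1ℚ) 1≤N
      0≤ε = ℚₚ.<⇒≤ 0<ε
      0≤16 = ℚₚ.nonNegative⁻¹ 16ℚ
  -- With c = 16 ε the gain near density ½ is close to 4 ε, while ν - μ = 2 `x` < 2 ε. The remaining
  -- 2 ε outweighs the loss 256 d ε³ and the second-order term 16 ε x² ≤ 16 ε³, because 272 = 256 +
  -- 16 is below 2 `κ`.
  in ℚₚ.<-irrefl (solve 4 (λ e d N m →
        con 0ℚ := (m :- (con ½ :- e)) :+ ((m :- (con ½ :- e))
          :+ (con 1ℚ :- m :- (m :+ con 16ℚ :* e :* (m :* (con 1ℚ :- m))
               :- d :* (con 16ℚ :* e :* (con 16ℚ :* e) :* (con 16ℚ :* e) :* con 1/16)))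
          :+ con 16ℚ :* e :* (m :- (con ½ :- e)) :* (e :+ (con ½ :- m))
          :+ con 16ℚ :* con 16ℚ :* e :* (e :* e) :* (N :- d)
          :+ con 16ℚ :* e :* (e :* e) :* (N :- con 1ℚ)
          :+ e :* (con (1ℚ + 1ℚ) :* (con 1ℚ :- e :* e :* (con κ :* N))
                   :+ con (κ + κ - ℕ→ℚ 272) :* (e :* e) :* N)))
      refl ε d N μ)
    (ℚₚ.+-mono-<-≤ 0<ε-x
      (ℚₚ.<⇒≤ 0<ε-x
       ⊹ ≤⇒0≤- iso
       ⊹ 0≤16 ⊠ 0≤ε ⊠ ℚₚ.<⇒≤ 0<ε-x ⊠ (0≤ε ⊹ 0≤x)
       ⊹ 0≤16 ⊠ 0≤16 ⊠ 0≤ε ⊠ 0≤p² ε ⊠ ≤⇒0≤- d≤N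
       ⊹ 0≤16 ⊠ 0≤ε ⊠ 0≤p² ε ⊠ ≤⇒0≤- 1≤N
       ⊹ 0≤ε ⊠ (ℚₚ.nonNegative⁻¹ (1ℚ + 1ℚ) ⊠ ≤⇒0≤- small
                ⊹ ℚₚ.nonNegative⁻¹ (κ + κ - ℕ→ℚ 272) ⊠ 0≤p² ε ⊠ 0≤N)))

-- Sums over the group

Σᴳ : ∀ {n} → (G n → ℚ) → ℚ
Σᴳ {zero}  f = f []
Σᴳ {suc n} f = Σᴳ (λ x → f (false ∷ x)) + Σᴳ (λ x → f (true ∷ x))

Σᴳ-average₂ : ∀ {n} (f h : G n → ℚ) → Σᴳ (λ x → ½ * (f x + h x)) ≡ ½ * (Σᴳ f + Σᴳ h)
Σᴳ-average₂ {zero}  f h = refl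
Σᴳ-average₂ {suc n} f h = trans
  (cong₂ _+_ (Σᴳ-average₂ (f ∘ (false ∷_)) (h ∘ (false ∷_))) (Σᴳ-average₂ (f ∘ (true ∷_)) (h ∘ (true ∷_))))
  (solve 4 (λ a b c d → con ½ :* (a :+ b) :+ con ½ :* (c :+ d) := con ½ :* (a :+ c :+ (b :+ d))) refl
    (Σᴳ (f ∘ (false ∷_))) (Σᴳ (h ∘ (false ∷_))) (Σᴳ (f ∘ (true ∷_))) (Σᴳ (h ∘ (true ∷_))))

Σᴳ-shift : ∀ {n} (f : G n → ℚ) z → Σᴳ (λ x → f (x ⊕ z)) ≡ Σᴳ f
Σᴳ-shift f []          = refl
Σᴳ-shift f (false ∷ z) = cong₂ _+_ (Σᴳ-shift (f ∘ (false ∷_)) z) (Σᴳ-shift (f ∘ (true ∷_)) z)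
Σᴳ-shift f (true ∷ z)  = trans
  (cong₂ _+_ (Σᴳ-shift (f ∘ (true ∷_)) z) (Σᴳ-shift (f ∘ (false ∷_)) z))
  (ℚₚ.+-comm (Σᴳ (f ∘ (true ∷_))) (Σᴳ (f ∘ (false ∷_))))

-- Translation invariance: every vertex of the cube contributes a full sum over the group. Hence a
-- bound valid on each cube passes to the whole set.
Σᴳ-average : ∀ {n} (zs : List (G n)) f → Σᴳ (average zs f) ≡ Σᴳ f
Σᴳ-average []       f = refl
Σᴳ-average (z ∷ zs) f = begin
  Σᴳ (average (z ∷ zs) f)                                         ≡⟨ Σᴳ-average₂ (average zs f) (λ g → average zs f (g ⊕ z)) ⟩
  ½ * (Σᴳ (average zs f) + Σᴳ (λ g → average zs f (g ⊕ z)))       ≡⟨ cong (λ t → ½ * (Σᴳ (average zs f) + t)) (Σᴳ-shift (average zs f) z) ⟩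
  ½ * (Σᴳ (average zs f) + Σᴳ (average zs f))                     ≡⟨ cong (λ t → ½ * (t + t)) (Σᴳ-average zs f) ⟩
  ½ * (Σᴳ f + Σᴳ f)                                               ≡⟨ solve 1 (λ a → con ½ :* (a :+ a) := a) refl (Σᴳ f) ⟩
  Σᴳ f                                                            ∎
  where open ≡-Reasoning

Σᴳ-≤ : ∀ {n} {f : G n → ℚ} {b} → (∀ x → f x ≤ b) → Σᴳ f ≤ b * ℕ→ℚ (2 ^ n)
Σᴳ-≤ {zero}  {f} {b} f≤b = subst (f [] ≤_) (sym (ℚₚ.*-identityʳ b)) (f≤b [])
Σᴳ-≤ {suc n} {f} {b} f≤b = subst (Σᴳ f ≤_) (begin
  b * ℕ→ℚ (2 ^ n) + b * ℕ→ℚ (2 ^ n)   ≡⟨ solve 2 (λ b t → b :* t :+ b :* t := b :* (con (ℕ→ℚ 2) :* t)) refl b (ℕ→ℚ (2 ^ n)) ⟩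
  b * (ℕ→ℚ 2 * ℕ→ℚ (2 ^ n))           ≡⟨ cong (b *_) (ℕ→ℚ-* 2 (2 ^ n)) ⟨
  b * ℕ→ℚ (2 ^ suc n)                 ∎)
  (ℚₚ.+-mono-≤ (Σᴳ-≤ (λ x → f≤b (false ∷ x))) (Σᴳ-≤ (λ x → f≤b (true ∷ x))))
  where open ≡-Reasoning

-- Indicator functions and cardinality

χ : Bool → ℚ
χ true  = 1ℚ
χ false = 0ℚ

length-filter-map : ∀ {X Y : Set} (A : Y → Bool) (φ : X → Y) xs →
  length (filter (λ y → A y ≟ᵇ true) (List.map φ xs)) ≡ length (filter (λ x → A (φ x) ≟ᵇ true) xs)
length-filter-map A φ []       = refl
length-filter-map A φ (x ∷ xs) with A (φ x)
... | true  = cong suc (length-filter-map A φ xs)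
... | false = length-filter-map A φ xs

card-suc : ∀ {n} (A : G (suc n) → Bool) → card A ≡ card (A ∘ (false ∷_)) ℕ.+ card (A ∘ (true ∷_))
card-suc {n} A = begin
  length (filter A? (F ++ T))                      ≡⟨ cong length (filter-++ A? F T) ⟩
  length (filter A? F ++ filter A? T)              ≡⟨ length-++ (filter A? F) ⟩
  length (filter A? F) ℕ.+ length (filter A? T)    ≡⟨ cong₂ ℕ._+_ (length-filter-map A _ (allG n)) (length-filter-map A _ (allG n)) ⟩
  card (A ∘ (false ∷_)) ℕ.+ card (A ∘ (true ∷_))   ∎
  where
  open ≡-Reasoning
  A? = λ x → A x ≟ᵇ true
  F = List.map (false ∷_) (allG n)
  T = List.map (true ∷_) (allG n)

card-Σᴳ : ∀ {n} (A : G n → Bool) → ℕ→ℚ (card A) ≡ Σᴳ (χ ∘ A)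
card-Σᴳ {zero}  A with A []
... | true  = refl
... | false = refl
card-Σᴳ {suc n} A = begin
  ℕ→ℚ (card A)                                             ≡⟨ cong ℕ→ℚ (card-suc A) ⟩
  ℕ→ℚ (card (A ∘ (false ∷_)) ℕ.+ card (A ∘ (true ∷_)))     ≡⟨ ℕ→ℚ-+ (card (A ∘ (false ∷_))) (card (A ∘ (true ∷_))) ⟩
  ℕ→ℚ (card (A ∘ (false ∷_))) + ℕ→ℚ (card (A ∘ (true ∷_))) ≡⟨ cong₂ _+_ (card-Σᴳ (A ∘ (false ∷_))) (card-Σᴳ (A ∘ (true ∷_))) ⟩
  Σᴳ (χ ∘ A)                                               ∎
  where open ≡-Reasoning

χ-idem : ∀ b → χ b * (1ℚ - χ b) ≡ 0ℚ
χ-idem true  = refl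
χ-idem false = refl

-- Turns a missing sum into a pointwise inequality; the inclusions A ⊆ B and A + zᵢ ⊆ B enter the
-- averages through it.
χ-disjoint : ∀ a b → ¬ (a ≡ true × b ≡ true) → χ a ≤ 1ℚ - χ b
χ-disjoint false false _  = ℚₚ.nonNegative⁻¹ 1ℚ
χ-disjoint false true  _  = ℚₚ.≤-refl
χ-disjoint true  false _  = ℚₚ.≤-refl
χ-disjoint true  true  ¬ab = contradiction (refl , refl) ¬ab

-- Missing sums and the conclusion

-- Only `a` is searched, its partner being forced to be `a ⊕ x`. Decidability makes the complement
-- of A + A a finite list and permits the removal of double negations.
_∈+?_ : ∀ {n} (x : G n) (A : G n → Bool) → Dec ((A +ₛ A) x)
x ∈+? A with any? (λ a → (A a ≟ᵇ true) ×-dec (A (a ⊕ x) ≟ᵇ true)) (allG _)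
... | yes some with find some
...   | a , _ , Aa , Aax = yes (a , a ⊕ x , Aa , Aax , sym (⊕-cancelˡ a x))
x ∈+? A | no none = no λ where
  (a , b , Aa , Ab , refl) → none (lose (∈-allG a) (Aa , trans (cong A (⊕-cancelˡ a b)) Ab))

SparseRelation : ∀ {n} → (G n → Bool) → Set
SparseRelation {n} A = ∃[ w ] ∃[ zs ]
  (¬ (A +ₛ A) w × All (λ z → ¬ (A +ₛ A) (z ⊕ w)) zs × length zs ℕ.≤ n × ⨁ zs ≡ w)

-- Every cube meets `A` in density at most ½ - ε, and summing these densities over all base points
-- recovers |A|.
relation⇒card≤ : ∀ {n} (A : G n → Bool) ε → n ≥ 1 → 0ℚ < ε → ε * ε * (κ * ℕ→ℚ n) ≤ 1ℚ →
  SparseRelation A → ℕ→ℚ (card A) ≤ (½ - ε) * ℕ→ℚ (2 ^ n)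
relation⇒card≤ {n} A ε n≥1 0<ε small (w , zs , w∉ , zs∉ , len , refl) = subst (_≤ (½ - ε) * ℕ→ℚ (2 ^ n))
  (trans (Σᴳ-average zs f) (sym (card-Σᴳ A)))
  (Σᴳ-≤ λ g → density-bound ε (ℕ→ℚ (length zs)) (ℕ→ℚ n) (average zs f g) (average zs h g) (average-h g)
    0<ε (ℕ→ℚ-mono len) (ℕ→ℚ-mono n≥1) small
    (average-mono zs f≤h g)
    (isoperimetry (16ℚ * ε) (ℚₚ.nonNegative⁻¹ 16ℚ ⊠ ℚₚ.<⇒≤ 0<ε) zs f h (χ-idem ∘ A) f≤h (All.map fz≤h zs∉) g))
  where
  f h : G n → ℚ
  f x = χ (A x)
  -- The indicator of B = {x : x + w ∉ A}.
  h x = 1ℚ - f (x ⊕ w)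

  f≤h : ∀ x → f x ≤ h x
  f≤h x = χ-disjoint (A x) (A (x ⊕ w)) λ (Ax , Axw) → w∉ (x , x ⊕ w , Ax , Axw , sym (⊕-cancelˡ x w))

  fz≤h : ∀ {z} → ¬ (A +ₛ A) (z ⊕ w) → ∀ x → f (x ⊕ z) ≤ h x
  fz≤h {z} zw∉ x = χ-disjoint (A (x ⊕ z)) (A (x ⊕ w)) λ (Axz , Axw) →
    zw∉ (x ⊕ z , x ⊕ w , Axz , Axw , sym (begin
      (x ⊕ z) ⊕ (x ⊕ w)  ≡⟨ ⊕-interchange x z x w ⟩
      (x ⊕ x) ⊕ (z ⊕ w)  ≡⟨ cong (_⊕ (z ⊕ w)) (⊕-same x) ⟩
      𝟘 n ⊕ (z ⊕ w)      ≡⟨ ⊕-identityˡ (z ⊕ w) ⟩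
      z ⊕ w              ∎))
    where open ≡-Reasoning

  -- Translation by w = `⨁ zs` permutes the vertices of the cube, so B has the density complementary
  -- to that of `A`.
  average-h : ∀ g → average zs h g ≡ 1ℚ - average zs f g
  average-h g = begin
    average zs h g                              ≡⟨ average-complement zs (λ x → f (x ⊕ w)) g ⟩
    1ℚ - average zs (λ x → f (x ⊕ w)) g         ≡⟨ cong (λ t → 1ℚ - t) (average-shift zs f w g) ⟩
    1ℚ - average zs f (g ⊕ w)                   ≡⟨ cong (λ t → 1ℚ - t) (average-⨁ zs f g) ⟩
    1ℚ - average zs f g                         ∎
    where open ≡-Reasoning

missing : ∀ {n} → (G n → Bool) → List (G n)
missing {n} A = filter (λ x → ¬? (x ∈+? A)) (allG n)

∈-missing⁺ : ∀ {n} (A : G n → Bool) {x} → ¬ (A +ₛ A) x → x ∈ missing A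
∈-missing⁺ A {x} = ∈-filter⁺ (λ x → ¬? (x ∈+? A)) (∈-allG x)

∈-missing⁻ : ∀ {n} (A : G n → Bool) {x} → x ∈ missing A → ¬ (A +ₛ A) x
∈-missing⁻ {n} A x∈ = proj₂ (∈-filter⁻ (λ x → ¬? (x ∈+? A)) {xs = allG n} x∈)

codim1-or-relation : ∀ {n} → n ≥ 1 → (A : G n → Bool) →
  ∃[ V ] (IsCodim1Subspace V × (∀ x → V x → (A +ₛ A) x)) ⊎ SparseRelation A
codim1-or-relation {suc n} n≥1 A with missing A in eq
-- The first coordinate, present because the dimension is positive, serves as functional.
... | [] = inj₁ ((λ x → dot e₁ x ≡ false) , hyperplane e₁ e₁ (cong not (dot-𝟘ˡ (𝟘 n))) ,
  λ x _ → decidable-stable (x ∈+? A) λ x∉ → contradiction (subst (x ∈_) eq (∈-missing⁺ A x∉)) λ ())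
  where
  e₁ : G (suc n)
  e₁ = true ∷ 𝟘 n
... | w ∷ _ with separate-or-sum (List.map (_⊕ w) (missing A)) w
...   | inj₁ (γ , γw , γL) = inj₁ ((λ x → dot γ x ≡ false) , hyperplane γ w γw , kernel⊆)
  where
  kernel⊆ : ∀ x → dot γ x ≡ false → (A +ₛ A) x
  -- A missing x puts x + w in the list on which γ vanishes, yet γ(x + w) = 0 + 1.
  kernel⊆ x γx = decidable-stable (x ∈+? A) λ x∉ → contradiction
    (trans (sym (trans (dot-⊕ γ x w) (cong₂ _xor_ γx γw)))
      (All.lookup γL (∈-map⁺ (_⊕ w) (∈-missing⁺ A x∉))))
    λ ()
...   | inj₂ (zs , zs∈ , len , sum) =
  inj₂ (w , zs , ∈-missing⁻ A (subst (w ∈_) (sym eq) (here refl)) , All.map avoids zs∈ , len , sum)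
  where
  avoids : ∀ {z} → z ∈ List.map (_⊕ w) (missing A) → ¬ (A +ₛ A) (z ⊕ w)
  avoids z∈ with ∈-map⁻ (_⊕ w) z∈
  ... | x , x∈ , refl = subst (λ y → ¬ (A +ₛ A) y) (sym (⊕-cancelʳ x w)) (∈-missing⁻ A x∈)

theorem1p2 : (n : ℕ) → n ≥ 1 → (A : G n → Bool) → (ε : ℚ) →
    0ℚ < ε → (ε * ε) * ℕ→ℚ (2 ^ 18 *ℕ n) ≤ 1ℚ →
    (½ - ε) * ℕ→ℚ (2 ^ n) < ℕ→ℚ (card A) →
    ∃[ V ] (IsCodim1Subspace V × (∀ x → V x → (A +ₛ A) x))
theorem1p2 n n≥1 A ε 0<ε small dense = [ id , ⊥-elim ∘ no-relation ]′ (codim1-or-relation n≥1 A)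
  where
  no-relation : ¬ SparseRelation A
  no-relation relation = ℚₚ.<-irrefl refl (ℚₚ.<-≤-trans dense
    (relation⇒card≤ A ε n≥1 0<ε (subst (λ t → ε * ε * t ≤ 1ℚ) (ℕ→ℚ-* (2 ^ 18) n) small) relation))
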